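{- Let $(T_n(X))_{n\ge 0}$ be a sequence of $q$-polynomials and, for every integer $n\ge 0$, set $t_n := T_n(0)$. Then $(T_n(X))_{n\ge 0}$ is Carlitz-type if and only if for all integers $n\ge 0$: $$T_n(X)=\sum_{k=0}^{n}\binom{n}{k}\,t_k\,q^{kX}\,[X]^{n-k}.$$
   Context: Let $q$ be a positive real number, $q\neq 1$, and put $[X]:=\frac{q^X-1}{q-1}$. A $q$-polynomial is a polynomial in $[X]$ (equivalently, in $q^X$) with real coefficients. A sequence $(T_n(X))_{n\ge 0}$ of $q$-polynomials is called Carlitz-type if there is a real sequence $(a_k)_{k\ge 0}$ (called its associated sequence) such that for all integers $n\ge 0$ $$T_n(X)=(q-1)^{ -n}\sum_{k=0}^{n}(-1)^{n-k}\binom{n}{k}a_k\,q^{kX}.$$ The convention $[X]^0=1$ is used. -}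

module Defs where

open import Algebra.Bundles using (CommutativeRing)
open import Data.Fin.Base using (toℕ)
open import Data.List.Base using (List; []; _∷_; map; foldr)
open import Data.Nat.Base as ℕ using (ℕ; zero; suc; _∸_; _⊔_)
import Data.Nat.Properties as ℕ
open import Data.Nat.Combinatorics using (_C_)
open import Data.Product.Base using (∃; _,_; proj₁; proj₂; _×_)
open import Data.Rational.Base as ℚ using (ℚ; 0ℚ; 1ℚ; ½; ∣_∣)
import Data.Rational.Properties as ℚ
open import Data.Rational.Solver using (module +-*-Solver)
open import Data.Sum.Base using (_⊎_; inj₁; inj₂)
open import Level using (0ℓ)
open import Relation.Binary.Core using (Rel)
open import Relation.Binary.PropositionalEquality
  using (_≡_; _≢_; refl; sym; trans; cong; cong₂; subst; subst₂)
open import Relation.Nullary using (yes; no; contradiction)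

infix 4 _~_

-- For Cauchy sequences this says that x and y have the same limit, and
-- x ~ x says that x is Cauchy.
_~_ : Rel (ℕ → ℚ) 0ℓ
x ~ y = ∀ {ε} → 0ℚ ℚ.< ε →
  ∃ λ N → ∀ {m n} → N ℕ.≤ m → N ℕ.≤ n → ∣ x m ℚ.- y n ∣ ℚ.< ε

-- Real numbers are Cauchy sequences of rationals, up to _≈_ below.
record ℝ : Set where
  constructor real
  field
    seq    : ℕ → ℚ
    cauchy : seq ~ seq

open ℝ public

private
  open +-*-Solver using (solve; _:+_; _:-_; _:*_; :-_; con; _:=_)

  half+half : ∀ ε → ½ ℚ.* ε ℚ.+ ½ ℚ.* ε ≡ ε
  half+half ε = trans (sym (ℚ.*-distribʳ-+ ε ½ ½)) (ℚ.*-identityˡ ε)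

  *-pos : ∀ {p r} → 0ℚ ℚ.< p → 0ℚ ℚ.< r → 0ℚ ℚ.< p ℚ.* r
  *-pos {p} {r} 0<p 0<r = subst (ℚ._< p ℚ.* r) (ℚ.*-zeroʳ p)
    (ℚ.*-monoʳ-<-pos p {{ℚ.positive 0<p}} 0<r)

  half-pos : ∀ {ε} → 0ℚ ℚ.< ε → 0ℚ ℚ.< ½ ℚ.* ε
  half-pos = *-pos (ℚ.positive⁻¹ ½)

  ∣-∣-sym : ∀ p r → ∣ p ℚ.- r ∣ ≡ ∣ r ℚ.- p ∣
  ∣-∣-sym p r = trans (sym (ℚ.∣-p∣≡∣p∣ (p ℚ.- r)))
    (cong ∣_∣ (solve 2 (λ p r → :- (p :- r) := r :- p) refl p r))

  add-halves : ∀ {p a b ε} → p ≡ a ℚ.+ b →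
               ∣ a ∣ ℚ.< ½ ℚ.* ε → ∣ b ∣ ℚ.< ½ ℚ.* ε → ∣ p ∣ ℚ.< ε
  add-halves {a = a} {b} {ε} refl a< b< =
    ℚ.≤-<-trans (ℚ.∣p+q∣≤∣p∣+∣q∣ a b)
      (subst (∣ a ∣ ℚ.+ ∣ b ∣ ℚ.<_) (half+half ε) (ℚ.+-mono-< a< b<))

  max₁ : ∀ M N {m} → M ⊔ N ℕ.≤ m → M ℕ.≤ m
  max₁ M N = ℕ.≤-trans (ℕ.m≤m⊔n M N)

  max₂ : ∀ M N {m} → M ⊔ N ℕ.≤ m → N ℕ.≤ m
  max₂ M N = ℕ.≤-trans (ℕ.m≤n⊔m M N)

  ~-sym : ∀ {x y} → x ~ y → y ~ x
  ~-sym {x} {y} x~y 0<ε with N , h ← x~y 0<ε =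
    N , λ {m} {n} N≤m N≤n →
      subst (ℚ._< _) (∣-∣-sym (x n) (y m)) (h N≤n N≤m)

  ~-trans : ∀ {x y z} → x ~ y → y ~ z → x ~ z
  ~-trans {x} {y} {z} x~y y~z 0<ε
    with M , f ← x~y (half-pos 0<ε) | N , g ← y~z (half-pos 0<ε) =
    M ⊔ N , λ {m} {n} ≤m ≤n →
      add-halves
        (solve 3 (λ a b c → a :- c := (a :- b) :+ (b :- c)) refl
          (x m) (y (M ⊔ N)) (z n))
        (f (max₁ M N ≤m) (ℕ.m≤m⊔n M N))
        (g (ℕ.m≤n⊔m M N) (max₂ M N ≤n))

  ~-respʳ : ∀ {x y z} → (∀ n → y n ≡ z n) → x ~ y → x ~ z
  ~-respʳ {x} y≡z x~y 0<ε with N , h ← x~y 0<ε =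
    N , λ {m} {n} N≤m N≤n →
      subst (λ t → ∣ x m ℚ.- t ∣ ℚ.< _) (y≡z n) (h N≤m N≤n)

  const~ : ∀ p → (λ _ → p) ~ (λ _ → p)
  const~ p {ε} 0<ε =
    0 , λ _ _ → subst (λ t → ∣ t ∣ ℚ.< ε) (sym (ℚ.+-inverseʳ p)) 0<ε

  +-~ : ∀ {x x′ y y′} → x ~ x′ → y ~ y′ →
        (λ n → x n ℚ.+ y n) ~ (λ n → x′ n ℚ.+ y′ n)
  +-~ {x} {x′} {y} {y′} x~ y~ 0<ε
    with M , f ← x~ (half-pos 0<ε) | N , g ← y~ (half-pos 0<ε) =
    M ⊔ N , λ {m} {n} ≤m ≤n →
      add-halves
        (solve 4 (λ a b c d → (a :+ b) :- (c :+ d) := (a :- c) :+ (b :- d))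
          refl (x m) (y m) (x′ n) (y′ n))
        (f (max₁ M N ≤m) (max₁ M N ≤n))
        (g (max₂ M N ≤m) (max₂ M N ≤n))

  neg-~ : ∀ {x y} → x ~ y → (λ n → ℚ.- x n) ~ (λ n → ℚ.- y n)
  neg-~ {x} {y} x~y 0<ε with N , h ← x~y 0<ε =
    N , λ {m} {n} N≤m N≤n →
      subst (ℚ._< _)
        (trans (∣-∣-sym (x m) (y n))
          (cong ∣_∣ (solve 2 (λ a b → b :- a := :- a :- :- b) refl
            (x m) (y n))))
        (h N≤m N≤n)

  Bound : (ℕ → ℚ) → Set
  Bound x = ∃ λ B → 0ℚ ℚ.< B × ∃ λ N → ∀ {n} → N ℕ.≤ n → ∣ x n ∣ ℚ.≤ B

  bound : ∀ {x} → x ~ x → Bound x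
  bound {x} x~x with N , h ← x~x (ℚ.positive⁻¹ 1ℚ) =
    1ℚ ℚ.+ ∣ x N ∣ ,
    ℚ.+-mono-<-≤ (ℚ.positive⁻¹ 1ℚ) (ℚ.0≤∣p∣ (x N)) ,
    N , λ {n} N≤n →
      subst (λ t → ∣ t ∣ ℚ.≤ 1ℚ ℚ.+ ∣ x N ∣)
        (solve 2 (λ a b → (a :- b) :+ b := a) refl (x n) (x N))
        (ℚ.≤-trans (ℚ.∣p+q∣≤∣p∣+∣q∣ (x n ℚ.- x N) (x N))
          (ℚ.+-monoˡ-≤ ∣ x N ∣ (ℚ.<⇒≤ (h N≤n ℕ.≤-refl))))

  quot : ∀ B → 0ℚ ℚ.< B → ℚ → ℚ
  quot B 0<B ε = ((ℚ.1/ B) {{ℚ.>-nonZero 0<B}}) ℚ.* ε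

  quot-pos : ∀ {B ε} (0<B : 0ℚ ℚ.< B) → 0ℚ ℚ.< ε → 0ℚ ℚ.< quot B 0<B ε
  quot-pos {B} 0<B = *-pos {(ℚ.1/ B) {{ℚ.>-nonZero 0<B}}}
    (ℚ.positive⁻¹ _ {{ℚ.1/pos⇒pos B {{ℚ.positive 0<B}}}})

  *-quot : ∀ {B} (0<B : 0ℚ ℚ.< B) ε → B ℚ.* quot B 0<B ε ≡ ε
  *-quot {B} 0<B ε = trans (sym (ℚ.*-assoc B _ ε))
    (trans (cong (ℚ._* ε) (ℚ.*-inverseʳ B {{ℚ.>-nonZero 0<B}}))
      (ℚ.*-identityˡ ε))

  bounded-* : ∀ {a d B ε} (0<B : 0ℚ ℚ.< B) → ∣ a ∣ ℚ.≤ B →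
              ∣ d ∣ ℚ.< quot B 0<B ε → ∣ a ℚ.* d ∣ ℚ.< ε
  bounded-* {a} {d} {B} {ε} 0<B a≤B d< =
    subst (ℚ._< ε) (sym (ℚ.∣p*q∣≡∣p∣*∣q∣ a d))
      (ℚ.≤-<-trans
        (ℚ.*-monoʳ-≤-nonNeg ∣ d ∣ {{ℚ.∣-∣-nonNeg d}} a≤B)
        (subst (B ℚ.* ∣ d ∣ ℚ.<_) (*-quot 0<B ε)
          (ℚ.*-monoʳ-<-pos B {{ℚ.positive 0<B}} d<)))

  *-diff : ∀ a b c d →
           a ℚ.* b ℚ.- c ℚ.* d ≡ a ℚ.* (b ℚ.- d) ℚ.+ d ℚ.* (a ℚ.- c)
  *-diff = solve 4 (λ a b c d →
    a :* b :- c :* d := a :* (b :- d) :+ d :* (a :- c)) refl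

  *-~-bounded : ∀ {x x′ y y′} → Bound x → Bound y′ → x ~ x′ → y ~ y′ →
                (λ n → x n ℚ.* y n) ~ (λ n → x′ n ℚ.* y′ n)
  *-~-bounded {x} {x′} {y} {y′}
    (B , 0<B , K , b) (D , 0<D , L , d) x~ y~ {ε} 0<ε =
    (K ⊔ L) ⊔ (proj₁ f ⊔ proj₁ g) , λ {m} {n} ≤m ≤n →
      add-halves {a = x m ℚ.* (y m ℚ.- y′ n)} {b = y′ n ℚ.* (x m ℚ.- x′ n)}
        (*-diff (x m) (y m) (x′ n) (y′ n))
        (bounded-* {x m} {y m ℚ.- y′ n} {B} {½ ℚ.* ε} 0<B
          (b (max₁ K L (max₁ (K ⊔ L) _ ≤m)))
          (proj₂ g (max₂ (proj₁ f) _ (max₂ (K ⊔ L) _ ≤m))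
                   (max₂ (proj₁ f) _ (max₂ (K ⊔ L) _ ≤n))))
        (bounded-* {y′ n} {x m ℚ.- x′ n} {D} {½ ℚ.* ε} 0<D
          (d (max₂ K L (max₁ (K ⊔ L) _ ≤n)))
          (proj₂ f (max₁ (proj₁ f) _ (max₂ (K ⊔ L) _ ≤m))
                   (max₁ (proj₁ f) _ (max₂ (K ⊔ L) _ ≤n))))
    where
    f : ∃ λ M → ∀ {m n} → M ℕ.≤ m → M ℕ.≤ n →
        ∣ x m ℚ.- x′ n ∣ ℚ.< quot D 0<D (½ ℚ.* ε)
    f = x~ (quot-pos 0<D (half-pos 0<ε))

    g : ∃ λ N → ∀ {m n} → N ℕ.≤ m → N ℕ.≤ n →
        ∣ y m ℚ.- y′ n ∣ ℚ.< quot B 0<B (½ ℚ.* ε)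
    g = y~ (quot-pos 0<B (half-pos 0<ε))

  *-~ : ∀ {x x′ y y′} → x ~ x′ → y ~ y′ →
        (λ n → x n ℚ.* y n) ~ (λ n → x′ n ℚ.* y′ n)
  *-~ {x} {x′} {y} {y′} x~ y~ = *-~-bounded {x} {x′} {y} {y′}
    (bound {x} (~-trans {x} {x′} {x} x~ (~-sym {x} {x′} x~)))
    (bound {y′} (~-trans {y′} {y} {y′} (~-sym {y} {y′} y~) y~))
    x~ y~

infix  4 _≈_ _<_ _#_
infixl 6 _+_ _-_
infixl 7 _*_
infix  8 -_

-- A record rather than a synonym for seq x ~ seq y, so that x and y can
-- be inferred from a proof of x ≈ y.
record _≈_ (x y : ℝ) : Set where
  constructor mk≈
  field
    sameLimit : seq x ~ seq y

open _≈_ public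

0ℝ 1ℝ : ℝ
0ℝ = real (λ _ → 0ℚ) (const~ 0ℚ)
1ℝ = real (λ _ → 1ℚ) (const~ 1ℚ)

_+_ _*_ : ℝ → ℝ → ℝ
x + y = real (λ n → seq x n ℚ.+ seq y n)
             (+-~ {seq x} {seq x} {seq y} {seq y} (cauchy x) (cauchy y))
x * y = real (λ n → seq x n ℚ.* seq y n)
             (*-~ {seq x} {seq x} {seq y} {seq y} (cauchy x) (cauchy y))

-_ : ℝ → ℝ
- x = real (λ n → ℚ.- seq x n) (neg-~ {seq x} {seq x} (cauchy x))

_-_ : ℝ → ℝ → ℝ
x - y = x + (- y)

_<_ : ℝ → ℝ → Set
x < y = ∃ λ ε → 0ℚ ℚ.< ε × ∃ λ N → ∀ {n} → N ℕ.≤ n →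
  ε ℚ.+ seq x n ℚ.≤ seq y n

-- Apartness is the constructive form of x ≠ y: it is what makes x - y
-- invertible, and classically it is equivalent to ¬ (x ≈ y).
_#_ : ℝ → ℝ → Set
x # y = x < y ⊎ y < x

private
  ≈-refl : ∀ {x} → x ≈ x
  ≈-refl {x} = mk≈ (cauchy x)

  pointwise : ∀ {x y} → (∀ n → seq x n ≡ seq y n) → x ≈ y
  pointwise {x} {y} x≡y =
    mk≈ (~-respʳ {seq x} {seq x} {seq y} x≡y (cauchy x))

ℝ-commutativeRing : CommutativeRing 0ℓ 0ℓ
ℝ-commutativeRing = record
  { Carrier = ℝ
  ; _≈_     = _≈_
  ; _+_     = _+_
  ; _*_     = _*_
  ; -_      = -_
  ; 0#      = 0ℝ
  ; 1#      = 1ℝ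
  ; isCommutativeRing = record
    { isRing = record
      { +-isAbelianGroup = record
        { isGroup = record
          { isMonoid = record
            { isSemigroup = record
              { isMagma = record
                { isEquivalence = record
                  { refl  = ≈-refl
                  ; sym   = λ {x} {y} (mk≈ e) →
                      mk≈ (~-sym {seq x} {seq y} e)
                  ; trans = λ {x} {y} {z} (mk≈ e) (mk≈ f) →
                      mk≈ (~-trans {seq x} {seq y} {seq z} e f)
                  }
                ; ∙-cong = λ {x} {x′} {y} {y′} (mk≈ e) (mk≈ f) →
                    mk≈ (+-~ {seq x} {seq x′} {seq y} {seq y′} e f)
                }
              ; assoc = λ x y z → pointwise λ n →
                  ℚ.+-assoc (seq x n) (seq y n) (seq z n)
              }
            ; identity = (λ x → pointwise λ n → ℚ.+-identityˡ (seq x n))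
                       , (λ x → pointwise λ n → ℚ.+-identityʳ (seq x n))
            }
          ; inverse = (λ x → pointwise λ n → ℚ.+-inverseˡ (seq x n))
                    , (λ x → pointwise λ n → ℚ.+-inverseʳ (seq x n))
          ; ⁻¹-cong = λ {x} {y} (mk≈ e) → mk≈ (neg-~ {seq x} {seq y} e)
          }
        ; comm = λ x y → pointwise λ n → ℚ.+-comm (seq x n) (seq y n)
        }
      ; *-cong = λ {x} {x′} {y} {y′} (mk≈ e) (mk≈ f) →
          mk≈ (*-~ {seq x} {seq x′} {seq y} {seq y′} e f)
      ; *-assoc = λ x y z → pointwise λ n →
          ℚ.*-assoc (seq x n) (seq y n) (seq z n)
      ; *-identity = (λ x → pointwise λ n → ℚ.*-identityˡ (seq x n))
                   , (λ x → pointwise λ n → ℚ.*-identityʳ (seq x n))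
      ; distrib = (λ x y z → pointwise λ n →
                    ℚ.*-distribˡ-+ (seq x n) (seq y n) (seq z n))
                , (λ x y z → pointwise λ n →
                    ℚ.*-distribʳ-+ (seq x n) (seq y n) (seq z n))
      }
    ; *-comm = λ x y → pointwise λ n → ℚ.*-comm (seq x n) (seq y n)
    }
  }

private
  recipℚ : ℚ → ℚ
  recipℚ p with p ℚ.≟ 0ℚ
  ... | yes _  = 0ℚ
  ... | no p≢0 = (ℚ.1/ p) {{ℚ.≢-nonZero p≢0}}

  *-recipℚ : ∀ p → p ≢ 0ℚ → p ℚ.* recipℚ p ≡ 1ℚ
  *-recipℚ p p≢0 with p ℚ.≟ 0ℚ
  ... | yes p≡0 = contradiction p≡0 p≢0
  ... | no p≢0′ = ℚ.*-inverseʳ p {{ℚ.≢-nonZero p≢0′}}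

  p≤∣p∣ : ∀ p → p ℚ.≤ ∣ p ∣
  p≤∣p∣ p with ℚ.≤-total 0ℚ p
  ... | inj₁ 0≤p = ℚ.≤-reflexive (sym (ℚ.0≤p⇒∣p∣≡p 0≤p))
  ... | inj₂ p≤0 = ℚ.≤-trans p≤0 (ℚ.0≤∣p∣ p)

  Away : (ℕ → ℚ) → Set
  Away x = ∃ λ ε → 0ℚ ℚ.< ε × ∃ λ N → ∀ {n} → N ℕ.≤ n → ε ℚ.≤ ∣ x n ∣

  away : ∀ x → x # 0ℝ → Away (seq x)
  away x (inj₁ (ε , 0<ε , N , h)) = ε , 0<ε , N , λ {n} N≤n →
    ℚ.≤-trans
      (subst (ℚ._≤ ℚ.- seq x n)
        (solve 2 (λ e a → (e :+ a) :- a := e) refl ε (seq x n))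
        (subst (ε ℚ.+ seq x n ℚ.- seq x n ℚ.≤_) (ℚ.+-identityˡ _)
          (ℚ.+-monoˡ-≤ (ℚ.- seq x n) (h N≤n))))
      (subst (ℚ.- seq x n ℚ.≤_) (ℚ.∣-p∣≡∣p∣ (seq x n))
        (p≤∣p∣ (ℚ.- seq x n)))
  away x (inj₂ (ε , 0<ε , N , h)) = ε , 0<ε , N , λ {n} N≤n →
    ℚ.≤-trans (subst (ℚ._≤ seq x n) (ℚ.+-identityʳ ε) (h N≤n))
      (p≤∣p∣ (seq x n))

  away⇒≢0 : ∀ {ε p} → 0ℚ ℚ.< ε → ε ℚ.≤ ∣ p ∣ → p ≢ 0ℚ
  away⇒≢0 0<ε ε≤∣p∣ refl = ℚ.<-irrefl refl (ℚ.<-≤-trans 0<ε ε≤∣p∣)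

  -- Away from 0 the reciprocals are bounded, hence
  -- 1/a - 1/b = (1/a) (1/b) (b - a) is small when b - a is.
  ∣recip∣≤ : ∀ {ε p} (0<ε : 0ℚ ℚ.< ε) → ε ℚ.≤ ∣ p ∣ →
             ∣ recipℚ p ∣ ℚ.≤ (ℚ.1/ ε) {{ℚ.>-nonZero 0<ε}}
  ∣recip∣≤ {ε} {p} 0<ε ε≤∣p∣ =
    ℚ.*-cancelˡ-≤-pos ε {{ℚ.positive 0<ε}}
      (subst (ε ℚ.* ∣ recipℚ p ∣ ℚ.≤_)
        (trans (trans (sym (ℚ.∣p*q∣≡∣p∣*∣q∣ p (recipℚ p)))
                      (cong ∣_∣ (*-recipℚ p (away⇒≢0 0<ε ε≤∣p∣))))
               (sym (ℚ.*-inverseʳ ε {{ℚ.>-nonZero 0<ε}})))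
        (ℚ.*-monoʳ-≤-nonNeg ∣ recipℚ p ∣ {{ℚ.∣-∣-nonNeg (recipℚ p)}}
          ε≤∣p∣))

  recip-diff : ∀ a b a′ b′ → a ℚ.* a′ ≡ 1ℚ → b ℚ.* b′ ≡ 1ℚ →
               a′ ℚ.* (b′ ℚ.* (b ℚ.- a)) ≡ a′ ℚ.- b′
  recip-diff a b a′ b′ aa′ bb′ = trans
    (solve 4 (λ a b a′ b′ → a′ :* (b′ :* (b :- a)) :=
                a′ :* (b :* b′) :- b′ :* (a :* a′)) refl a b a′ b′)
    (cong₂ ℚ._-_ (trans (cong (a′ ℚ.*_) bb′) (ℚ.*-identityʳ a′))
                 (trans (cong (b′ ℚ.*_) aa′) (ℚ.*-identityʳ b′)))

  recip-~ : ∀ {x} → x ~ x → Away x →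
            (λ n → recipℚ (x n)) ~ (λ n → recipℚ (x n))
  recip-~ {x} x~x (δ , 0<δ , K , h) {ε} 0<ε =
    K ⊔ proj₁ close , λ {m} {n} ≤m ≤n →
      subst (λ t → ∣ t ∣ ℚ.< ε)
        (recip-diff (x m) (x n) (recipℚ (x m)) (recipℚ (x n))
          (*-recipℚ (x m) (away⇒≢0 0<δ (h (max₁ K _ ≤m))))
          (*-recipℚ (x n) (away⇒≢0 0<δ (h (max₁ K _ ≤n)))))
        (bounded-* {a = recipℚ (x m)} 0<B
          (∣recip∣≤ 0<δ (h (max₁ K _ ≤m)))
          (bounded-* {a = recipℚ (x n)} 0<B
            (∣recip∣≤ 0<δ (h (max₁ K _ ≤n)))
            (proj₂ close (max₂ K _ ≤n) (max₂ K _ ≤m))))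
    where
    0<B : 0ℚ ℚ.< (ℚ.1/ δ) {{ℚ.>-nonZero 0<δ}}
    0<B = ℚ.positive⁻¹ _ {{ℚ.1/pos⇒pos δ {{ℚ.positive 0<δ}}}}

    close : ∃ λ N → ∀ {m n} → N ℕ.≤ m → N ℕ.≤ n →
            ∣ x m ℚ.- x n ∣ ℚ.< quot _ 0<B (quot _ 0<B ε)
    close = x~x (quot-pos 0<B (quot-pos 0<B 0<ε))

-- The terms of the sequence of x that vanish (finitely many, as x # 0)
-- are sent to 0.
recip : (x : ℝ) → x # 0ℝ → ℝ
recip x x#0 = real (λ n → recipℚ (seq x n))
                   (recip-~ {seq x} (cauchy x) (away x x#0))

private
  *-recip~1 : ∀ {x} → Away x →
              (λ n → x n ℚ.* recipℚ (x n)) ~ (λ _ → 1ℚ)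
  *-recip~1 {x} (δ , 0<δ , N , h) {ε} 0<ε = N , λ {m} N≤m _ →
    subst (λ t → ∣ t ℚ.- 1ℚ ∣ ℚ.< ε)
      (sym (*-recipℚ (x m) (away⇒≢0 0<δ (h N≤m)))) 0<ε

*-inverseʳ : ∀ x (x#0 : x # 0ℝ) → x * recip x x#0 ≈ 1ℝ
*-inverseʳ x x#0 = mk≈ (*-recip~1 {seq x} (away x x#0))

#⇒-#0 : ∀ {x y} → x # y → x - y # 0ℝ
#⇒-#0 {x} {y} (inj₁ (ε , 0<ε , N , h)) = inj₁ (ε , 0<ε , N , λ {n} N≤n →
  subst₂ ℚ._≤_ (ℚ.+-assoc ε (seq x n) (ℚ.- seq y n))
    (ℚ.+-inverseʳ (seq y n))
    (ℚ.+-monoˡ-≤ (ℚ.- seq y n) (h N≤n)))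
#⇒-#0 {x} {y} (inj₂ (ε , 0<ε , N , h)) = inj₂ (ε , 0<ε , N , λ {n} N≤n →
  subst (ℚ._≤ seq x n ℚ.- seq y n)
    (solve 2 (λ e b → (e :+ b) :- b := e :+ con 0ℚ) refl ε (seq y n))
    (ℚ.+-monoˡ-≤ (ℚ.- seq y n) (h N≤n)))

module Polynomial {c ℓ} (R : CommutativeRing c ℓ) where

  private module R = CommutativeRing R
  open R using (Carrier; 0#; 1#)
  open import Algebra.Properties.Ring R.ring using (-0#≈0#)
  open import Relation.Binary.Reasoning.Setoid R.setoid

  -- Coefficients from degree 0 upwards. Trailing zeros are allowed, and
  -- ignored by the equality below.
  Poly : Set c
  Poly = List Carrier

  coeff : Poly → ℕ → Carrier
  coeff []      _       = 0#
  coeff (a ∷ p) zero    = a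
  coeff (a ∷ p) (suc n) = coeff p n

  infix  4 _≈ₚ_
  infixl 6 _+ₚ_
  infixl 7 _*ₚ_
  infixr 7 _·_
  infix  8 -ₚ_

  record _≈ₚ_ (p r : Poly) : Set ℓ where
    constructor mk≈ₚ
    field
      coeffs : ∀ n → coeff p n R.≈ coeff r n

  open _≈ₚ_ public

  0ₚ 1ₚ : Poly
  0ₚ = []
  1ₚ = 1# ∷ []

  _+ₚ_ : Poly → Poly → Poly
  []      +ₚ r       = r
  (a ∷ p) +ₚ []      = a ∷ p
  (a ∷ p) +ₚ (b ∷ r) = (a R.+ b) ∷ (p +ₚ r)

  -ₚ_ : Poly → Poly
  -ₚ_ = map (λ a → R.- a)

  _·_ : Carrier → Poly → Poly
  a · p = map (a R.*_) p

  _*ₚ_ : Poly → Poly → Poly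
  []      *ₚ r = []
  (a ∷ p) *ₚ r = (a · r) +ₚ (0# ∷ (p *ₚ r))

  eval : Poly → Carrier → Carrier
  eval p y = foldr (λ a v → a R.+ y R.* v) 0# p

  coeff-+ : ∀ p r n → coeff (p +ₚ r) n R.≈ coeff p n R.+ coeff r n
  coeff-+ []      r       n       = R.sym (R.+-identityˡ _)
  coeff-+ (a ∷ p) []      n       = R.sym (R.+-identityʳ _)
  coeff-+ (a ∷ p) (b ∷ r) zero    = R.refl
  coeff-+ (a ∷ p) (b ∷ r) (suc n) = coeff-+ p r n

  coeff-neg : ∀ p n → coeff (-ₚ p) n R.≈ R.- coeff p n
  coeff-neg []      n       = R.sym -0#≈0#
  coeff-neg (a ∷ p) zero    = R.refl
  coeff-neg (a ∷ p) (suc n) = coeff-neg p n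

  coeff-· : ∀ a p n → coeff (a · p) n R.≈ a R.* coeff p n
  coeff-· a []      n       = R.sym (R.zeroʳ a)
  coeff-· a (b ∷ p) zero    = R.refl
  coeff-· a (b ∷ p) (suc n) = coeff-· a p n

  ≈ₚ-refl : ∀ {p} → p ≈ₚ p
  ≈ₚ-refl = mk≈ₚ λ _ → R.refl

  ≈ₚ-sym : ∀ {p r} → p ≈ₚ r → r ≈ₚ p
  ≈ₚ-sym e = mk≈ₚ λ n → R.sym (coeffs e n)

  ≈ₚ-trans : ∀ {p r s} → p ≈ₚ r → r ≈ₚ s → p ≈ₚ s
  ≈ₚ-trans e f = mk≈ₚ λ n → R.trans (coeffs e n) (coeffs f n)

  ∷-cong : ∀ {a b p r} → a R.≈ b → p ≈ₚ r → (a ∷ p) ≈ₚ (b ∷ r)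
  ∷-cong a≈b p≈r = mk≈ₚ λ { zero → a≈b ; (suc n) → coeffs p≈r n }

  0∷0 : (0# ∷ []) ≈ₚ []
  0∷0 = mk≈ₚ λ { zero → R.refl ; (suc n) → R.refl }

  +ₚ-cong : ∀ {p p′ r r′} → p ≈ₚ p′ → r ≈ₚ r′ → (p +ₚ r) ≈ₚ (p′ +ₚ r′)
  +ₚ-cong {p} {p′} {r} {r′} e f = mk≈ₚ λ n → begin
    coeff (p +ₚ r) n           ≈⟨ coeff-+ p r n ⟩
    coeff p n R.+ coeff r n    ≈⟨ R.+-cong (coeffs e n) (coeffs f n) ⟩
    coeff p′ n R.+ coeff r′ n  ≈⟨ coeff-+ p′ r′ n ⟨
    coeff (p′ +ₚ r′) n         ∎

  +ₚ-assoc : ∀ p r s → ((p +ₚ r) +ₚ s) ≈ₚ (p +ₚ (r +ₚ s))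
  +ₚ-assoc p r s = mk≈ₚ λ n → begin
    coeff ((p +ₚ r) +ₚ s) n                    ≈⟨ coeff-+ (p +ₚ r) s n ⟩
    coeff (p +ₚ r) n R.+ coeff s n             ≈⟨ R.+-congʳ (coeff-+ p r n) ⟩
    (coeff p n R.+ coeff r n) R.+ coeff s n    ≈⟨ R.+-assoc _ _ _ ⟩
    coeff p n R.+ (coeff r n R.+ coeff s n)    ≈⟨ R.+-congˡ (coeff-+ r s n) ⟨
    coeff p n R.+ coeff (r +ₚ s) n             ≈⟨ coeff-+ p (r +ₚ s) n ⟨
    coeff (p +ₚ (r +ₚ s)) n                    ∎

  +ₚ-comm : ∀ p r → (p +ₚ r) ≈ₚ (r +ₚ p)
  +ₚ-comm p r = mk≈ₚ λ n → begin
    coeff (p +ₚ r) n         ≈⟨ coeff-+ p r n ⟩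
    coeff p n R.+ coeff r n  ≈⟨ R.+-comm _ _ ⟩
    coeff r n R.+ coeff p n  ≈⟨ coeff-+ r p n ⟨
    coeff (r +ₚ p) n         ∎

  +ₚ-identityʳ : ∀ p → (p +ₚ []) ≈ₚ p
  +ₚ-identityʳ p = +ₚ-comm p []

  +ₚ-inverseˡ : ∀ p → ((-ₚ p) +ₚ p) ≈ₚ []
  +ₚ-inverseˡ p = mk≈ₚ λ n → begin
    coeff ((-ₚ p) +ₚ p) n           ≈⟨ coeff-+ (-ₚ p) p n ⟩
    coeff (-ₚ p) n R.+ coeff p n    ≈⟨ R.+-congʳ (coeff-neg p n) ⟩
    (R.- coeff p n) R.+ coeff p n   ≈⟨ R.-‿inverseˡ _ ⟩
    0#                              ∎

  -ₚ-cong : ∀ {p r} → p ≈ₚ r → (-ₚ p) ≈ₚ (-ₚ r)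
  -ₚ-cong {p} {r} e = mk≈ₚ λ n → begin
    coeff (-ₚ p) n    ≈⟨ coeff-neg p n ⟩
    R.- coeff p n     ≈⟨ R.-‿cong (coeffs e n) ⟩
    R.- coeff r n     ≈⟨ coeff-neg r n ⟨
    coeff (-ₚ r) n    ∎

  +ₚ-interchange : ∀ p r s t →
                   ((p +ₚ r) +ₚ (s +ₚ t)) ≈ₚ ((p +ₚ s) +ₚ (r +ₚ t))
  +ₚ-interchange p r s t = ≈ₚ-trans (+ₚ-assoc p r (s +ₚ t))
    (≈ₚ-trans (+ₚ-cong (≈ₚ-refl {p})
      (≈ₚ-trans (≈ₚ-sym (+ₚ-assoc r s t))
        (≈ₚ-trans (+ₚ-cong (+ₚ-comm r s) (≈ₚ-refl {t}))
          (+ₚ-assoc s r t))))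
      (≈ₚ-sym (+ₚ-assoc p s (r +ₚ t))))

  ·-cong : ∀ {a b p r} → a R.≈ b → p ≈ₚ r → (a · p) ≈ₚ (b · r)
  ·-cong {a} {b} {p} {r} a≈b e = mk≈ₚ λ n → begin
    coeff (a · p) n   ≈⟨ coeff-· a p n ⟩
    a R.* coeff p n   ≈⟨ R.*-cong a≈b (coeffs e n) ⟩
    b R.* coeff r n   ≈⟨ coeff-· b r n ⟨
    coeff (b · r) n   ∎

  0·p≈0 : ∀ p → (0# · p) ≈ₚ []
  0·p≈0 p = mk≈ₚ λ n → R.trans (coeff-· 0# p n) (R.zeroˡ _)

  1·p≈p : ∀ p → (1# · p) ≈ₚ p
  1·p≈p p = mk≈ₚ λ n → R.trans (coeff-· 1# p n) (R.*-identityˡ _)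

  ·-assoc : ∀ a b p → ((a R.* b) · p) ≈ₚ (a · (b · p))
  ·-assoc a b p = mk≈ₚ λ n → begin
    coeff ((a R.* b) · p) n     ≈⟨ coeff-· (a R.* b) p n ⟩
    (a R.* b) R.* coeff p n     ≈⟨ R.*-assoc _ _ _ ⟩
    a R.* (b R.* coeff p n)     ≈⟨ R.*-congˡ (coeff-· b p n) ⟨
    a R.* coeff (b · p) n       ≈⟨ coeff-· a (b · p) n ⟨
    coeff (a · (b · p)) n       ∎

  ·-distribʳ : ∀ p a b → ((a R.+ b) · p) ≈ₚ ((a · p) +ₚ (b · p))
  ·-distribʳ p a b = mk≈ₚ λ n → begin
    coeff ((a R.+ b) · p) n                 ≈⟨ coeff-· (a R.+ b) p n ⟩
    (a R.+ b) R.* coeff p n                 ≈⟨ R.distribʳ _ _ _ ⟩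
    a R.* coeff p n R.+ b R.* coeff p n     ≈⟨ R.+-cong (coeff-· a p n) (coeff-· b p n) ⟨
    coeff (a · p) n R.+ coeff (b · p) n     ≈⟨ coeff-+ (a · p) (b · p) n ⟨
    coeff ((a · p) +ₚ (b · p)) n            ∎

  ·-distribˡ : ∀ a p r → (a · (p +ₚ r)) ≈ₚ ((a · p) +ₚ (a · r))
  ·-distribˡ a p r = mk≈ₚ λ n → begin
    coeff (a · (p +ₚ r)) n                  ≈⟨ coeff-· a (p +ₚ r) n ⟩
    a R.* coeff (p +ₚ r) n                  ≈⟨ R.*-congˡ (coeff-+ p r n) ⟩
    a R.* (coeff p n R.+ coeff r n)         ≈⟨ R.distribˡ _ _ _ ⟩
    a R.* coeff p n R.+ a R.* coeff r n     ≈⟨ R.+-cong (coeff-· a p n) (coeff-· a r n) ⟨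
    coeff (a · p) n R.+ coeff (a · r) n     ≈⟨ coeff-+ (a · p) (a · r) n ⟨
    coeff ((a · p) +ₚ (a · r)) n            ∎

  0∷-+ : ∀ p r → (0# ∷ (p +ₚ r)) ≈ₚ ((0# ∷ p) +ₚ (0# ∷ r))
  0∷-+ p r = ∷-cong (R.sym (R.+-identityˡ 0#)) ≈ₚ-refl

  *ₚ-zeroʳ : ∀ p → (p *ₚ []) ≈ₚ []
  *ₚ-zeroʳ []      = ≈ₚ-refl
  *ₚ-zeroʳ (a ∷ p) = ≈ₚ-trans (∷-cong R.refl (*ₚ-zeroʳ p)) 0∷0

  *ₚ-∷ʳ : ∀ p b r → (p *ₚ (b ∷ r)) ≈ₚ ((b · p) +ₚ (0# ∷ (p *ₚ r)))
  *ₚ-∷ʳ []      b r = ≈ₚ-sym 0∷0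
  *ₚ-∷ʳ (a ∷ p) b r = ∷-cong (R.+-congʳ (R.*-comm a b))
    (≈ₚ-trans (+ₚ-cong (≈ₚ-refl {a · r}) (*ₚ-∷ʳ p b r))
      (≈ₚ-trans (≈ₚ-sym (+ₚ-assoc (a · r) (b · p) _))
        (≈ₚ-trans (+ₚ-cong (+ₚ-comm (a · r) (b · p)) ≈ₚ-refl)
          (+ₚ-assoc (b · p) (a · r) _))))

  *ₚ-comm : ∀ p r → (p *ₚ r) ≈ₚ (r *ₚ p)
  *ₚ-comm []      r = ≈ₚ-sym (*ₚ-zeroʳ r)
  *ₚ-comm (a ∷ p) r = ≈ₚ-trans
    (+ₚ-cong (≈ₚ-refl {a · r}) (∷-cong R.refl (*ₚ-comm p r)))
    (≈ₚ-sym (*ₚ-∷ʳ r a p))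

  *ₚ-congˡ : ∀ p {r s} → r ≈ₚ s → (p *ₚ r) ≈ₚ (p *ₚ s)
  *ₚ-congˡ []      e = ≈ₚ-refl
  *ₚ-congˡ (a ∷ p) e =
    +ₚ-cong (·-cong R.refl e) (∷-cong R.refl (*ₚ-congˡ p e))

  *ₚ-cong : ∀ {p p′ r r′} → p ≈ₚ p′ → r ≈ₚ r′ → (p *ₚ r) ≈ₚ (p′ *ₚ r′)
  *ₚ-cong {p} {p′} {r} {r′} e f = ≈ₚ-trans (*ₚ-congˡ p f)
    (≈ₚ-trans (*ₚ-comm p r′)
      (≈ₚ-trans (*ₚ-congˡ r′ e) (*ₚ-comm r′ p′)))

  *ₚ-distribʳ : ∀ s p r → ((p +ₚ r) *ₚ s) ≈ₚ ((p *ₚ s) +ₚ (r *ₚ s))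
  *ₚ-distribʳ s []      r       = ≈ₚ-refl
  *ₚ-distribʳ s (a ∷ p) []      = ≈ₚ-sym (+ₚ-identityʳ _)
  *ₚ-distribʳ s (a ∷ p) (b ∷ r) = ≈ₚ-trans
    (+ₚ-cong (·-distribʳ s a b)
      (≈ₚ-trans (∷-cong R.refl (*ₚ-distribʳ s p r))
        (0∷-+ (p *ₚ s) (r *ₚ s))))
    (+ₚ-interchange (a · s) (b · s) _ _)

  *ₚ-distribˡ : ∀ s p r → (s *ₚ (p +ₚ r)) ≈ₚ ((s *ₚ p) +ₚ (s *ₚ r))
  *ₚ-distribˡ s p r = ≈ₚ-trans (*ₚ-comm s (p +ₚ r))
    (≈ₚ-trans (*ₚ-distribʳ s p r)
      (+ₚ-cong (*ₚ-comm p s) (*ₚ-comm r s)))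

  ·-*ₚ : ∀ a p r → ((a · p) *ₚ r) ≈ₚ (a · (p *ₚ r))
  ·-*ₚ a []      r = ≈ₚ-refl
  ·-*ₚ a (b ∷ p) r = ≈ₚ-trans
    (+ₚ-cong (·-assoc a b r)
      (∷-cong (R.sym (R.zeroʳ a)) (·-*ₚ a p r)))
    (≈ₚ-sym (·-distribˡ a (b · r) (0# ∷ (p *ₚ r))))

  *ₚ-assoc : ∀ p r s → ((p *ₚ r) *ₚ s) ≈ₚ (p *ₚ (r *ₚ s))
  *ₚ-assoc []      r s = ≈ₚ-refl
  *ₚ-assoc (a ∷ p) r s = ≈ₚ-trans
    (*ₚ-distribʳ s (a · r) (0# ∷ (p *ₚ r)))
    (+ₚ-cong (·-*ₚ a r s)
      (≈ₚ-trans (+ₚ-cong (0·p≈0 s) ≈ₚ-refl)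
        (∷-cong R.refl (*ₚ-assoc p r s))))

  *ₚ-identityˡ : ∀ p → (1ₚ *ₚ p) ≈ₚ p
  *ₚ-identityˡ p = ≈ₚ-trans (+ₚ-cong (1·p≈p p) 0∷0) (+ₚ-identityʳ p)

  polyRing : CommutativeRing c ℓ
  polyRing = record
    { Carrier = Poly
    ; _≈_     = _≈ₚ_
    ; _+_     = _+ₚ_
    ; _*_     = _*ₚ_
    ; -_      = -ₚ_
    ; 0#      = 0ₚ
    ; 1#      = 1ₚ
    ; isCommutativeRing = record
      { isRing = record
        { +-isAbelianGroup = record
          { isGroup = record
            { isMonoid = record
              { isSemigroup = record
                { isMagma = record
                  { isEquivalence = record
                    { refl  = ≈ₚ-refl
                    ; sym   = ≈ₚ-sym
                    ; trans = ≈ₚ-trans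
                    }
                  ; ∙-cong = +ₚ-cong
                  }
                ; assoc = +ₚ-assoc
                }
              ; identity = (λ _ → ≈ₚ-refl) , +ₚ-identityʳ
              }
            ; inverse = +ₚ-inverseˡ
                      , (λ p → ≈ₚ-trans (+ₚ-comm p (-ₚ p)) (+ₚ-inverseˡ p))
            ; ⁻¹-cong = -ₚ-cong
            }
          ; comm = +ₚ-comm
          }
        ; *-cong = *ₚ-cong
        ; *-assoc = *ₚ-assoc
        ; *-identity = *ₚ-identityˡ
                     , (λ p → ≈ₚ-trans (*ₚ-comm p 1ₚ) (*ₚ-identityˡ p))
        ; distrib = *ₚ-distribˡ , *ₚ-distribʳ
        }
      ; *-comm = *ₚ-comm
      }
    }

open Polynomial ℝ-commutativeRing public
open CommutativeRing ℝ-commutativeRing using (semiring)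
open CommutativeRing polyRing using () renaming (semiring to polySemiring)
open import Algebra.Properties.Semiring.Exp semiring public using (_^_)
open import Algebra.Properties.Semiring.Exp polySemiring public
  using () renaming (_^_ to _^ₚ_)
open import Algebra.Properties.Semiring.Mult polySemiring public
  using () renaming (_×_ to _×ₚ_)
open import Algebra.Properties.Semiring.Sum polySemiring public
  using (sum⁺-syntax)

-- Real polynomials in q^X, treated as an indeterminate. As q is positive
-- and apart from 1, q^X takes infinitely many values, so two of them are
-- equal as functions of X exactly when they have the same coefficients.
QPoly : Set
QPoly = Poly

q^X : QPoly
q^X = 0ℝ ∷ 1ℝ ∷ []

module QCalculus (q : ℝ) (q#1 : q # 1ℝ) where

  1/[q-1] : ℝ
  1/[q-1] = recip (q - 1ℝ) (#⇒-#0 {q} {1ℝ} q#1)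

  [X] : QPoly
  [X] = 1/[q-1] · (q^X +ₚ -ₚ 1ₚ)

  -- The value at X = m, where q^X takes the value q ^ m.
  infix 9 _at_
  _at_ : QPoly → ℕ → ℝ
  P at m = eval P (q ^ m)

  IsCarlitzTypeWith : (ℕ → ℝ) → (ℕ → QPoly) → Set
  IsCarlitzTypeWith a T = ∀ n →
    T n ≈ₚ (1/[q-1] ^ n) ·
      (∑[ k ≤ n ] ((n C toℕ k) ×ₚ
        (((- 1ℝ) ^ (n ∸ toℕ k) * a (toℕ k)) · q^X ^ₚ toℕ k)))

  IsCarlitzType : (ℕ → QPoly) → Set
  IsCarlitzType T = ∃ λ a → IsCarlitzTypeWith a T

{-# OPTIONS --safe #-}

-- Write B_s u for the binomial transform (B_s u)_n = Σ_k C(n,k) s^(n-k) u_k.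
-- It satisfies B_s B_r = B_(s+r), and multiplying u_k by x^k turns B_s into
-- x^n B_(s/x). With d = 1/(q-1) and y = q^X, a sequence with associated
-- sequence a is T_n = d^n B_(-1) (y^k a_k), and then t_n = d^n B_(-1) a. Hence
-- the right-hand side of the theorem is
-- d^n B_(y-1) (y^k B_(-1) a) = d^n B_(y-1) B_(-y) (y^k a_k) = T_n.
-- As B_(-1) is invertible, every t arises in this way from some a.
module Submission where

open import Algebra.Bundles using (CommutativeRing; Semiring)
open import Algebra.Morphism.Structures using (module SemiringMorphisms)
import Algebra.Properties.AbelianGroup as AbelianGroupProperties
import Algebra.Properties.CommutativeSemigroup as CommutativeSemigroupProperties
import Algebra.Properties.CommutativeSemiring.Exp as Exp
import Algebra.Properties.Ring as RingProperties
import Algebra.Properties.Semiring.Mult as Mult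
import Algebra.Properties.Semiring.Sum as Sum
open import Data.Fin.Base using (Fin; fromℕ; inject₁; toℕ)
open import Data.Fin.Properties using (toℕ-fromℕ; toℕ-inject₁; toℕ≤pred[n])
open import Data.List.Base using ([]; _∷_)
open import Data.Nat.Base as ℕ using (ℕ; zero; suc; _∸_)
open import Data.Nat.Combinatorics
  using (_C_; k>n⇒nCk≡0; nCk+nC[k+1]≡[n+1]C[k+1])
open import Data.Nat.Properties using (n<1+n; +-∸-assoc)
open import Data.Product.Base using (∃; _,_)
open import Function.Base using (_∘_)
open import Function.Bundles using (_⇔_; mk⇔)
open import Relation.Binary.PropositionalEquality using (cong)
import Relation.Binary.Reasoning.Setoid as ≈-Reasoning
open import Defs using (module Polynomial)

-- Algebra of the binomial transform over a commutative ring.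

module BinomialTransform {c ℓ} (R : CommutativeRing c ℓ) where

  open CommutativeRing R
  open Exp commutativeSemiring using (_^_; ^-congˡ; ^-congʳ; ^-distrib-*)
  open Mult semiring using (_×_; ×-congʳ; ×-congˡ; ×-homo-+; ×-comm-*)
  open Sum semiring
    using (sum⁺-syntax; sum-cong-≋; sum-init-last; ∑-distrib-+; *-distribˡ-sum)
  open CommutativeSemigroupProperties +-commutativeSemigroup using ()
    renaming (interchange to +-interchange)
  open CommutativeSemigroupProperties *-commutativeSemigroup using ()
    renaming (x∙yz≈y∙xz to x*yz≈y*xz; interchange to *-interchange)
  open ≈-Reasoning setoid

  -- Pascal's rule turned into a recursion: with `E` the shift `u ↦ u ∘ suc`, this is `(s + E) ^ n`
  -- applied to `u` and read off at index 0. Unlike the sum, it contains neither binomial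
  -- coefficients nor truncated subtraction, so the laws below follow by induction on `n` for all
  -- `u` at once.
  transform : Carrier → ℕ → (ℕ → Carrier) → Carrier
  transform s zero    u = u 0
  transform s (suc n) u = s * transform s n u + transform s n (u ∘ suc)

  transform-cong : ∀ {s r} n {u v : ℕ → Carrier} → s ≈ r → (∀ k → u k ≈ v k) →
                   transform s n u ≈ transform r n v
  transform-cong zero    s≈r u≈v = u≈v 0
  transform-cong (suc n) s≈r u≈v = +-cong
    (*-cong s≈r (transform-cong n s≈r u≈v))
    (transform-cong n s≈r (u≈v ∘ suc))

  transform-+ : ∀ s n u v →
    transform s n (λ k → u k + v k) ≈ transform s n u + transform s n v
  transform-+ s zero    u v = refl
  transform-+ s (suc n) u v = begin
    s * transform s n (λ k → u k + v k)
      + transform s n (λ k → u (suc k) + v (suc k))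
      ≈⟨ +-cong (*-congˡ (transform-+ s n u v))
                (transform-+ s n (u ∘ suc) (v ∘ suc)) ⟩
    s * (transform s n u + transform s n v)
      + (transform s n (u ∘ suc) + transform s n (v ∘ suc))
      ≈⟨ +-congʳ (distribˡ _ _ _) ⟩
    (s * transform s n u + s * transform s n v)
      + (transform s n (u ∘ suc) + transform s n (v ∘ suc))
      ≈⟨ +-interchange _ _ _ _ ⟩
    transform s (suc n) u + transform s (suc n) v ∎

  transform-* : ∀ s n x u →
    transform s n (λ k → x * u k) ≈ x * transform s n u
  transform-* s zero    x u = refl
  transform-* s (suc n) x u = begin
    s * transform s n (λ k → x * u k) + transform s n (λ k → x * u (suc k))
      ≈⟨ +-cong (*-congˡ (transform-* s n x u)) (transform-* s n x (u ∘ suc)) ⟩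
    s * (x * transform s n u) + x * transform s n (u ∘ suc)
      ≈⟨ +-congʳ (x*yz≈y*xz _ _ _) ⟩
    x * (s * transform s n u) + x * transform s n (u ∘ suc)
      ≈⟨ distribˡ _ _ _ ⟨
    x * transform s (suc n) u ∎

  -- Shifting `x ^ k * u k` produces one more factor `x`, so every factor `x * s + E` of the
  -- operator releases exactly one `x`.
  transform-scale : ∀ x s n u →
    transform (x * s) n (λ k → x ^ k * u k) ≈ x ^ n * transform s n u
  transform-scale x s zero    u = refl
  transform-scale x s (suc n) u = begin
    x * s * transform (x * s) n (λ k → x ^ k * u k)
      + transform (x * s) n (λ k → x * x ^ k * u (suc k))
      ≈⟨ +-cong (*-congˡ (transform-scale x s n u))
                (transform-cong n refl (λ k → *-assoc _ _ _)) ⟩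
    x * s * (x ^ n * transform s n u)
      + transform (x * s) n (λ k → x * (x ^ k * u (suc k)))
      ≈⟨ +-cong (*-interchange _ _ _ _) (transform-* (x * s) n x _) ⟩
    x * x ^ n * (s * transform s n u)
      + x * transform (x * s) n (λ k → x ^ k * u (suc k))
      ≈⟨ +-congˡ (*-congˡ (transform-scale x s n (u ∘ suc))) ⟩
    x * x ^ n * (s * transform s n u) + x * (x ^ n * transform s n (u ∘ suc))
      ≈⟨ +-congˡ (*-assoc _ _ _) ⟨
    x * x ^ n * (s * transform s n u) + x * x ^ n * transform s n (u ∘ suc)
      ≈⟨ distribˡ _ _ _ ⟨
    x ^ suc n * transform s (suc n) u ∎

  -- Shifting the sequence `transform r k u` in `k` amounts to applying `r + E` to `u`. By linearity
  -- the outer factor `s + E` therefore acts on `u` as `(s + r) + E`.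
  transform-transform : ∀ s r n u →
    transform s n (λ k → transform r k u) ≈ transform (s + r) n u
  transform-transform s r zero    u = refl
  transform-transform s r (suc n) u = begin
    s * transform s n (λ k → transform r k u)
      + transform s n (λ k → r * transform r k u + transform r k (u ∘ suc))
      ≈⟨ +-congˡ (transform-+ s n _ _) ⟩
    s * transform s n (λ k → transform r k u)
      + (transform s n (λ k → r * transform r k u)
         + transform s n (λ k → transform r k (u ∘ suc)))
      ≈⟨ +-congˡ (+-congʳ (transform-* s n r _)) ⟩
    s * transform s n (λ k → transform r k u)
      + (r * transform s n (λ k → transform r k u)
         + transform s n (λ k → transform r k (u ∘ suc)))
      ≈⟨ +-assoc _ _ _ ⟨
    s * transform s n (λ k → transform r k u)
      + r * transform s n (λ k → transform r k u)
      + transform s n (λ k → transform r k (u ∘ suc))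
      ≈⟨ +-congʳ (distribʳ _ _ _) ⟨
    (s + r) * transform s n (λ k → transform r k u)
      + transform s n (λ k → transform r k (u ∘ suc))
      ≈⟨ +-cong (*-congˡ (transform-transform s r n u))
                (transform-transform s r n (u ∘ suc)) ⟩
    transform (s + r) (suc n) u ∎

  transform-0 : ∀ n u → transform 0# n u ≈ u n
  transform-0 zero    u = refl
  transform-0 (suc n) u =
    trans (+-cong (zeroˡ _) (transform-0 n (u ∘ suc))) (+-identityˡ _)

  -- Binomial sums as transforms.

  term : Carrier → (ℕ → Carrier) → ℕ → ℕ → Carrier
  term s u n k = s ^ (n ∸ k) * u k

  -- One half of Pascal's rule. The top summand vanishes because `n C suc n` is 0, and each
  -- remaining one has a power of `s` to spare.
  sum-C-suc : ∀ s u n →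
    ∑[ k ≤ suc n ] ((n C toℕ k) × term s u (suc n) (toℕ k)) ≈
    s * ∑[ k ≤ n ] ((n C toℕ k) × term s u n (toℕ k))
  sum-C-suc s u n = begin
    ∑[ k ≤ suc n ] g (toℕ k)
      ≈⟨ sum-init-last {suc n} (g ∘ toℕ) ⟩
    ∑[ k ≤ n ] g (toℕ (inject₁ k)) + g (toℕ (fromℕ (suc n)))
      ≈⟨ +-cong (sum-cong-≋ {suc n} g-init) g-last ⟩
    ∑[ k ≤ n ] (s * ((n C toℕ k) × term s u n (toℕ k))) + 0#
      ≈⟨ +-identityʳ _ ⟩
    ∑[ k ≤ n ] (s * ((n C toℕ k) × term s u n (toℕ k)))
      ≈⟨ *-distribˡ-sum {suc n} s (λ k → (n C toℕ k) × term s u n (toℕ k)) ⟨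
    s * ∑[ k ≤ n ] ((n C toℕ k) × term s u n (toℕ k)) ∎
    where
    g : ℕ → Carrier
    g k = (n C k) × term s u (suc n) k

    g-last : g (toℕ (fromℕ (suc n))) ≈ 0#
    g-last = begin
      g (toℕ (fromℕ (suc n)))  ≡⟨ cong g (toℕ-fromℕ (suc n)) ⟩
      g (suc n)                ≈⟨ ×-congˡ (k>n⇒nCk≡0 (n<1+n n)) ⟩
      0#                       ∎

    g-init : ∀ (k : Fin (suc n)) →
             g (toℕ (inject₁ k)) ≈ s * ((n C toℕ k) × term s u n (toℕ k))
    g-init k = begin
      g (toℕ (inject₁ k))
        ≡⟨ cong g (toℕ-inject₁ k) ⟩
      (n C toℕ k) × (s ^ (suc n ∸ toℕ k) * u (toℕ k))
        -- Truncated subtraction gives `suc n ∸ toℕ k` as `suc (n ∸ toℕ k)` only because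
        -- `toℕ k ≤ n`.
        ≈⟨ ×-congʳ (n C toℕ k)
             (*-congʳ (^-congʳ s (+-∸-assoc 1 (toℕ≤pred[n] k)))) ⟩
      (n C toℕ k) × (s * s ^ (n ∸ toℕ k) * u (toℕ k))
        ≈⟨ ×-congʳ (n C toℕ k) (*-assoc _ _ _) ⟩
      (n C toℕ k) × (s * term s u n (toℕ k))
        ≈⟨ ×-comm-* (n C toℕ k) _ _ ⟨
      s * ((n C toℕ k) × term s u n (toℕ k)) ∎

  -- Pascal's rule splits the sum in two. The coefficients `n C suc k`, completed by the term at 0,
  -- give `s * transform s n u`; the coefficients `n C k` give the transform of the shifted
  -- sequence.
  sum≈transform : ∀ s n u →
    ∑[ k ≤ n ] ((n C toℕ k) × term s u n (toℕ k)) ≈ transform s n u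
  sum≈transform s zero    u =
    trans (+-identityʳ _) (trans (+-identityʳ _) (*-identityˡ _))
  sum≈transform s (suc n) u = begin
    e₀ + ∑[ k ≤ n ] ((suc n C suc (toℕ k)) × e k)
      ≈⟨ +-congˡ (sum-cong-≋ {suc n} pascal) ⟩
    e₀ + ∑[ k ≤ n ] ((n C suc (toℕ k)) × e k + (n C toℕ k) × e k)
      ≈⟨ +-congˡ (∑-distrib-+ {suc n} (λ k → (n C suc (toℕ k)) × e k)
                                      (λ k → (n C toℕ k) × e k)) ⟩
    e₀ + (∑[ k ≤ n ] ((n C suc (toℕ k)) × e k) + ∑[ k ≤ n ] ((n C toℕ k) × e k))
      ≈⟨ +-assoc _ _ _ ⟨
    -- The term at 0 is absorbed by computation: `suc n C 0` and `n C 0` both reduce to 1, and `e k`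
    -- reduces to the term of index `suc (toℕ k)` for `suc n`.
    ∑[ k ≤ suc n ] ((n C toℕ k) × term s u (suc n) (toℕ k))
      + ∑[ k ≤ n ] ((n C toℕ k) × e k)
      ≈⟨ +-cong (trans (sum-C-suc s u n) (*-congˡ (sum≈transform s n u)))
                (sum≈transform s n (u ∘ suc)) ⟩
    transform s (suc n) u ∎
    where
    e₀ : Carrier
    e₀ = 1 × term s u (suc n) 0

    e : Fin (suc n) → Carrier
    e k = term s (u ∘ suc) n (toℕ k)

    pascal : ∀ k → (suc n C suc (toℕ k)) × e k ≈
                   (n C suc (toℕ k)) × e k + (n C toℕ k) × e k
    pascal k = begin
      (suc n C suc (toℕ k)) × e k
        ≈⟨ ×-congˡ (nCk+nC[k+1]≡[n+1]C[k+1] n (toℕ k)) ⟨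
      (n C toℕ k ℕ.+ n C suc (toℕ k)) × e k
        ≈⟨ ×-homo-+ (e k) (n C toℕ k) _ ⟩
      (n C toℕ k) × e k + (n C suc (toℕ k)) × e k
        ≈⟨ +-comm _ _ ⟩
      (n C suc (toℕ k)) × e k + (n C toℕ k) × e k ∎

  -- Scaling, composition and inversion combined.

  -- Scaling by `y` moves `y ^ k` inside the inner transform and changes `r` to `y * r`; scaling by
  -- `d` extracts `d ^ n`; composition then adds the two parameters. It is applied with `s = y - 1`
  -- and `r = -1`.
  transform-^ : ∀ d y s r (v a : ℕ → Carrier) →
    (∀ k → v k ≈ d ^ k * transform r k a) → ∀ n →
    transform (d * s) n (λ k → v k * y ^ k) ≈
    d ^ n * transform (s + y * r) n (λ k → a k * y ^ k)
  transform-^ d y s r v a v≈ n = begin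
    transform (d * s) n (λ k → v k * y ^ k)
      ≈⟨ transform-cong n refl rearrange ⟩
    transform (d * s) n
      (λ k → d ^ k * transform (y * r) k (λ j → a j * y ^ j))
      ≈⟨ transform-scale d s n _ ⟩
    d ^ n * transform s n (λ k → transform (y * r) k (λ j → a j * y ^ j))
      ≈⟨ *-congˡ (transform-transform s (y * r) n _) ⟩
    d ^ n * transform (s + y * r) n (λ k → a k * y ^ k) ∎
    where
    rearrange : ∀ k → v k * y ^ k ≈
                d ^ k * transform (y * r) k (λ j → a j * y ^ j)
    rearrange k = begin
      v k * y ^ k                      ≈⟨ *-congʳ (v≈ k) ⟩
      d ^ k * transform r k a * y ^ k  ≈⟨ *-assoc _ _ _ ⟩
      d ^ k * (transform r k a * y ^ k)
        ≈⟨ *-congˡ (*-comm _ _) ⟩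
      d ^ k * (y ^ k * transform r k a)
        ≈⟨ *-congˡ (transform-scale y r k a) ⟨
      d ^ k * transform (y * r) k (λ j → y ^ j * a j)
        ≈⟨ *-congˡ (transform-cong k refl (λ j → *-comm _ _)) ⟩
      d ^ k * transform (y * r) k (λ j → a j * y ^ j) ∎

  -- The transforms with parameters -1 and 1 compose to the one with parameter 0, the identity, and
  -- `d ^ n` cancels `c ^ n`. This supplies the associated sequence in the converse direction.
  transform-invert : ∀ c d → c * d ≈ 1# → ∀ (v : ℕ → Carrier) n →
    v n ≈ d ^ n * transform (- 1#) n
                    (λ k → transform 1# k (λ j → c ^ j * v j))
  transform-invert c d cd≈1 v n = begin
    v n                      ≈⟨ *-identityˡ _ ⟨
    1# * v n                 ≈⟨ *-congʳ (1^n≈1 n) ⟨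
    1# ^ n * v n             ≈⟨ *-congʳ (^-congˡ n (trans (*-comm d c) cd≈1)) ⟨
    (d * c) ^ n * v n        ≈⟨ *-congʳ (^-distrib-* d c n) ⟩
    d ^ n * c ^ n * v n      ≈⟨ *-assoc _ _ _ ⟩
    d ^ n * (c ^ n * v n)    ≈⟨ *-congˡ (transform-0 n _) ⟨
    d ^ n * transform 0# n (λ j → c ^ j * v j)
      ≈⟨ *-congˡ (transform-cong n (-‿inverseˡ 1#) (λ _ → refl)) ⟨
    d ^ n * transform (- 1# + 1#) n (λ j → c ^ j * v j)
      ≈⟨ *-congˡ (transform-transform (- 1#) 1# n _) ⟨
    d ^ n * transform (- 1#) n (λ k → transform 1# k (λ j → c ^ j * v j)) ∎
    where
    1^n≈1 : ∀ n → 1# ^ n ≈ 1#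
    1^n≈1 zero    = refl
    1^n≈1 (suc n) = trans (*-identityˡ _) (1^n≈1 n)

-- Transforms under semiring homomorphisms.

module _ {a b ℓ₁ ℓ₂} (A : CommutativeRing a ℓ₁) (B : CommutativeRing b ℓ₂) where

  private
    module A = CommutativeRing A
    module B = CommutativeRing B
    module EA = Exp A.commutativeSemiring
    module EB = Exp B.commutativeSemiring

  open SemiringMorphisms (Semiring.rawSemiring A.semiring)
                         (Semiring.rawSemiring B.semiring)
    using (IsSemiringHomomorphism)
  open BinomialTransform

  module _ {f : A.Carrier → B.Carrier} (hom : IsSemiringHomomorphism f) where

    open IsSemiringHomomorphism hom

    ^-homo : ∀ x n → f (x EA.^ n) B.≈ f x EB.^ n
    ^-homo x zero    = 1#-homo
    ^-homo x (suc n) = B.trans (*-homo x _) (B.*-congˡ (^-homo x n))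

    transform-homo : ∀ s n u →
      f (transform A s n u) B.≈ transform B (f s) n (f ∘ u)
    transform-homo s zero    u = B.refl
    transform-homo s (suc n) u = B.trans (+-homo _ _) (B.+-cong
      (B.trans (*-homo s _) (B.*-congˡ (transform-homo s n u)))
      (transform-homo s n (u ∘ suc)))

-- Constant polynomials and evaluation as homomorphisms.

module PolynomialHomomorphisms {c ℓ} (R : CommutativeRing c ℓ) where

  open CommutativeRing R
  open Polynomial R
  open CommutativeSemigroupProperties +-commutativeSemigroup using ()
    renaming (interchange to +-interchange)
  open CommutativeSemigroupProperties *-commutativeSemigroup using ()
    renaming (x∙yz≈y∙xz to x*yz≈y*xz)
  open ≈-Reasoning setoid
  private module P = CommutativeRing polyRing

  const : Carrier → Poly
  const a = a ∷ []

  ·≈const* : ∀ a p → a · p ≈ₚ const a *ₚ p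
  ·≈const* a p = ≈ₚ-sym
    (≈ₚ-trans (+ₚ-cong (≈ₚ-refl {a · p}) 0∷0) (+ₚ-identityʳ (a · p)))

  -- Together with `·≈const*` this turns scalars into elements of the polynomial ring, where the
  -- transform laws apply to coefficients and powers of `y` alike.
  const-isHomomorphism :
    SemiringMorphisms.IsSemiringHomomorphism
      (Semiring.rawSemiring semiring) (Semiring.rawSemiring P.semiring) const
  const-isHomomorphism = record
    { isNearSemiringHomomorphism = record
      { +-isMonoidHomomorphism = record
        { isMagmaHomomorphism = record
          { isRelHomomorphism = record { cong = λ a≈b → ∷-cong a≈b ≈ₚ-refl }
          ; homo = λ a b → ≈ₚ-refl
          }
        ; ε-homo = 0∷0
        }
      ; *-homo = λ a b → ·≈const* a (const b)
      }
    ; 1#-homo = ≈ₚ-refl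
    }

  module _ (y : Carrier) where

    ev : Poly → Carrier
    ev p = eval p y

    -- Equal polynomials may be lists of different lengths, since trailing zeros are ignored; this
    -- disposes of the surplus in `eval-cong`.
    eval-[] : ∀ p → p ≈ₚ [] → ev p ≈ 0#
    eval-[] []      e = refl
    eval-[] (a ∷ p) e = begin
      a + y * ev p  ≈⟨ +-cong (coeffs e 0) (*-congˡ (eval-[] p (mk≈ₚ (coeffs e ∘ suc)))) ⟩
      0# + y * 0#   ≈⟨ +-identityˡ _ ⟩
      y * 0#        ≈⟨ zeroʳ y ⟩
      0#            ∎

    eval-cong : ∀ {p r} → p ≈ₚ r → ev p ≈ ev r
    eval-cong {[]}    {r}     e = sym (eval-[] r (≈ₚ-sym e))
    eval-cong {a ∷ p} {[]}    e = eval-[] (a ∷ p) e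
    eval-cong {a ∷ p} {b ∷ r} e =
      +-cong (coeffs e 0) (*-congˡ (eval-cong {p} {r} (mk≈ₚ (coeffs e ∘ suc))))

    eval-+ : ∀ p r → ev (p +ₚ r) ≈ ev p + ev r
    eval-+ []      r       = sym (+-identityˡ _)
    eval-+ (a ∷ p) []      = sym (+-identityʳ _)
    eval-+ (a ∷ p) (b ∷ r) = begin
      a + b + y * ev (p +ₚ r)        ≈⟨ +-congˡ (*-congˡ (eval-+ p r)) ⟩
      a + b + y * (ev p + ev r)      ≈⟨ +-congˡ (distribˡ _ _ _) ⟩
      a + b + (y * ev p + y * ev r)  ≈⟨ +-interchange _ _ _ _ ⟩
      ev (a ∷ p) + ev (b ∷ r)        ∎

    eval-· : ∀ a p → ev (a · p) ≈ a * ev p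
    eval-· a []      = sym (zeroʳ a)
    eval-· a (b ∷ p) = begin
      a * b + y * ev (a · p)  ≈⟨ +-congˡ (*-congˡ (eval-· a p)) ⟩
      a * b + y * (a * ev p)  ≈⟨ +-congˡ (x*yz≈y*xz _ _ _) ⟩
      a * b + a * (y * ev p)  ≈⟨ distribˡ _ _ _ ⟨
      a * ev (b ∷ p)          ∎

    eval-* : ∀ p r → ev (p *ₚ r) ≈ ev p * ev r
    eval-* []      r = sym (zeroˡ _)
    eval-* (a ∷ p) r = begin
      ev ((a · r) +ₚ (0# ∷ (p *ₚ r)))      ≈⟨ eval-+ (a · r) _ ⟩
      ev (a · r) + (0# + y * ev (p *ₚ r))  ≈⟨ +-cong (eval-· a r) (+-identityˡ _) ⟩
      a * ev r + y * ev (p *ₚ r)           ≈⟨ +-congˡ (*-congˡ (eval-* p r)) ⟩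
      a * ev r + y * (ev p * ev r)         ≈⟨ +-congˡ (*-assoc _ _ _) ⟨
      a * ev r + y * ev p * ev r           ≈⟨ distribʳ _ _ _ ⟨
      ev (a ∷ p) * ev r                    ∎

    eval-const : ∀ a → ev (const a) ≈ a
    eval-const a = trans (+-congˡ (zeroʳ y)) (+-identityʳ a)

    eval-isHomomorphism :
      SemiringMorphisms.IsSemiringHomomorphism
        (Semiring.rawSemiring P.semiring) (Semiring.rawSemiring semiring) ev
    eval-isHomomorphism = record
      { isNearSemiringHomomorphism = record
        { +-isMonoidHomomorphism = record
          { isMagmaHomomorphism = record
            { isRelHomomorphism = record { cong = eval-cong }
            ; homo = eval-+
            }
          ; ε-homo = refl
          }
        ; *-homo = eval-*
        }
      ; 1#-homo = eval-const 1#
      }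

-- The two expansions over an arbitrary commutative ring.

module CarlitzType {c ℓ} (R : CommutativeRing c ℓ) where

  open CommutativeRing R
  open Polynomial R
  open PolynomialHomomorphisms R
  open BinomialTransform R using (transform; transform-cong; transform-invert)
  private
    module P = CommutativeRing polyRing
    module T = BinomialTransform polyRing
  open Exp commutativeSemiring using (_^_; ^-congˡ)
  open Exp P.commutativeSemiring using ()
    renaming (_^_ to _^ₚ_; ^-congˡ to ^ₚ-congˡ)
  open Mult P.semiring using () renaming (_×_ to _×ₚ_; ×-congʳ to ×ₚ-congʳ)
  open Sum P.semiring using (sum⁺-syntax; sum-cong-≋)
  open CommutativeSemigroupProperties P.*-commutativeSemigroup using ()
    renaming (x∙yz≈z∙xy to x*yz≈z*xy)

  -- The point is written `q ^ 0`, which reduces to `1#`, to match evaluation at `X = 0`.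
  value : Carrier → Poly → Carrier
  value q p = eval p (q ^ 0)

  [_]-number : Carrier → Poly → Poly
  [ d ]-number y = d · (y +ₚ -ₚ 1ₚ)

  indeterminate : Poly
  indeterminate = 0# ∷ 1# ∷ []

  -- For the multiplication _∙_, m = -1, y = q^X and X = [X]. They are parameters
  -- so that at ℝ these sums contain the terms of Defs literally: comparing
  -- products of reals up to unfolding means comparing their Cauchy proofs, which
  -- is infeasible.
  module _ (_∙_ : Carrier → Carrier → Carrier) (m d : Carrier)
           (y X : Poly) where

    carlitzSum : (ℕ → Carrier) → ℕ → Poly
    carlitzSum a n = (d ^ n) · ∑[ k ≤ n ] ((n C toℕ k) ×ₚ
      (((m ^ (n ∸ toℕ k)) ∙ a (toℕ k)) · y ^ₚ toℕ k))

    valueSum : (ℕ → Carrier) → ℕ → Poly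
    valueSum t n = ∑[ k ≤ n ] ((n C toℕ k) ×ₚ
      (t (toℕ k) · (y ^ₚ toℕ k *ₚ X ^ₚ (n ∸ toℕ k))))

    module _ (∙≈* : ∀ x z → x ∙ z ≈ x * z) (m≈-1 : m ≈ - 1#)
             (y≈indeterminate : y ≈ₚ indeterminate)
             (X≈[d] : X ≈ₚ [ d ]-number y) where

      carlitzSum≈transform : ∀ a n → carlitzSum a n ≈ₚ
        const d ^ₚ n *ₚ T.transform (-ₚ 1ₚ) n (λ k → const (a k) *ₚ y ^ₚ k)
      carlitzSum≈transform a n = P.trans (·≈const* (d ^ n) _) (P.*-cong
        (^-homo R polyRing const-isHomomorphism d n)
        (P.trans
          (sum-cong-≋ {suc n} (λ k →
            ×ₚ-congʳ (n C toℕ k) (monomial (n ∸ toℕ k) (toℕ k))))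
          (T.sum≈transform (-ₚ 1ₚ) n _)))
        where
        monomial : ∀ j k → ((m ^ j) ∙ a k) · y ^ₚ k ≈ₚ
                           (-ₚ 1ₚ) ^ₚ j *ₚ (const (a k) *ₚ y ^ₚ k)
        monomial j k = begin
          ((m ^ j) ∙ a k) · y ^ₚ k
            ≈⟨ ·-cong (trans (∙≈* _ _) (*-congʳ (^-congˡ j m≈-1))) ≈ₚ-refl ⟩
          ((- 1#) ^ j * a k) · y ^ₚ k
            ≈⟨ ·-assoc _ (a k) _ ⟩
          ((- 1#) ^ j) · (a k · y ^ₚ k)
            ≈⟨ ·≈const* _ _ ⟩
          const ((- 1#) ^ j) *ₚ (a k · y ^ₚ k)
            ≈⟨ P.*-cong (^-homo R polyRing const-isHomomorphism (- 1#) j)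
                        (·≈const* (a k) _) ⟩
          (-ₚ 1ₚ) ^ₚ j *ₚ (const (a k) *ₚ y ^ₚ k) ∎
          where open ≈-Reasoning P.setoid

      -- The bracket `X` is `d` times `y - 1`, so its powers serve as the powers of the transform
      -- parameter.
      valueSum≈transform : ∀ t n → valueSum t n ≈ₚ
        T.transform (const d *ₚ (y +ₚ -ₚ 1ₚ)) n (λ k → const (t k) *ₚ y ^ₚ k)
      valueSum≈transform t n = P.trans
        (sum-cong-≋ {suc n} (λ k →
          ×ₚ-congʳ (n C toℕ k) (monomial (n ∸ toℕ k) (toℕ k))))
        (T.sum≈transform _ n _)
        where
        monomial : ∀ j k → t k · (y ^ₚ k *ₚ X ^ₚ j) ≈ₚ
          (const d *ₚ (y +ₚ -ₚ 1ₚ)) ^ₚ j *ₚ (const (t k) *ₚ y ^ₚ k)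
        monomial j k = begin
          t k · (y ^ₚ k *ₚ X ^ₚ j)
            ≈⟨ ·≈const* (t k) _ ⟩
          const (t k) *ₚ (y ^ₚ k *ₚ X ^ₚ j)
            ≈⟨ x*yz≈z*xy (const (t k)) (y ^ₚ k) _ ⟩
          X ^ₚ j *ₚ (const (t k) *ₚ y ^ₚ k)
            ≈⟨ P.*-congʳ (^ₚ-congˡ j (P.trans X≈[d] (·≈const* d _))) ⟩
          (const d *ₚ (y +ₚ -ₚ 1ₚ)) ^ₚ j *ₚ (const (t k) *ₚ y ^ₚ k) ∎
          where open ≈-Reasoning P.setoid

      -- The identity behind both directions: `transform-^` in the polynomial ring, once the
      -- relation between `t` and `a` has been carried there by `const`.
      valueSum≈carlitzSum : ∀ t a →
        (∀ k → t k ≈ d ^ k * transform (- 1#) k a) →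
        ∀ n → valueSum t n ≈ₚ carlitzSum a n
      valueSum≈carlitzSum t a t≈ n = begin
        valueSum t n
          ≈⟨ valueSum≈transform t n ⟩
        T.transform (const d *ₚ (y +ₚ -ₚ 1ₚ)) n (λ k → const (t k) *ₚ y ^ₚ k)
          ≈⟨ T.transform-^ (const d) y (y +ₚ -ₚ 1ₚ) (-ₚ 1ₚ)
               (const ∘ t) (const ∘ a) t≈ₚ n ⟩
        const d ^ₚ n *ₚ
          T.transform ((y +ₚ -ₚ 1ₚ) +ₚ y *ₚ -ₚ 1ₚ) n (λ k → const (a k) *ₚ y ^ₚ k)
          ≈⟨ P.*-congˡ {const d ^ₚ n}
               (T.transform-cong n parameter (λ _ → ≈ₚ-refl)) ⟩
        const d ^ₚ n *ₚ T.transform (-ₚ 1ₚ) n (λ k → const (a k) *ₚ y ^ₚ k)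
          ≈⟨ carlitzSum≈transform a n ⟨
        carlitzSum a n ∎
        where
        open ≈-Reasoning P.setoid

        t≈ₚ : ∀ k → const (t k) ≈ₚ
                    const d ^ₚ k *ₚ T.transform (-ₚ 1ₚ) k (const ∘ a)
        t≈ₚ k = begin
          const (t k)
            ≈⟨ ∷-cong (t≈ k) ≈ₚ-refl ⟩
          const (d ^ k * transform (- 1#) k a)
            ≈⟨ ·≈const* (d ^ k) _ ⟩
          const (d ^ k) *ₚ const (transform (- 1#) k a)
            ≈⟨ P.*-cong (^-homo R polyRing const-isHomomorphism d k)
                 (transform-homo R polyRing const-isHomomorphism (- 1#) k a) ⟩
          const d ^ₚ k *ₚ T.transform (-ₚ 1ₚ) k (const ∘ a) ∎

        -- Here `(y - 1) - y = -1` restores the parameter of the Carlitz sum.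
        parameter : (y +ₚ -ₚ 1ₚ) +ₚ y *ₚ -ₚ 1ₚ ≈ₚ -ₚ 1ₚ
        parameter = begin
          (y +ₚ -ₚ 1ₚ) +ₚ y *ₚ -ₚ 1ₚ  ≈⟨ P.+-congˡ {y +ₚ -ₚ 1ₚ} y*-1≈-y ⟩
          (y +ₚ -ₚ 1ₚ) +ₚ -ₚ y        ≈⟨ xyx⁻¹≈y y (-ₚ 1ₚ) ⟩
          -ₚ 1ₚ                       ∎
          where
          open AbelianGroupProperties P.+-abelianGroup using (xyx⁻¹≈y)
          open RingProperties P.ring using (-1*x≈-x)

          y*-1≈-y : y *ₚ -ₚ 1ₚ ≈ₚ -ₚ y
          y*-1≈-y = P.trans (*ₚ-comm y (-ₚ 1ₚ)) (-1*x≈-x y)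

      -- At `X = 0` the indeterminate `y` takes the value 1, so every `y ^ₚ k` disappears and the
      -- transform of `a` alone remains.
      eval-carlitzSum-1 : ∀ a n →
        eval (carlitzSum a n) 1# ≈ d ^ n * transform (- 1#) n a
      eval-carlitzSum-1 a n = begin
        ev 1# (carlitzSum a n)
          ≈⟨ eval-cong 1# (carlitzSum≈transform a n) ⟩
        ev 1# (const d ^ₚ n
          *ₚ T.transform (-ₚ 1ₚ) n (λ k → const (a k) *ₚ y ^ₚ k))
          ≈⟨ eval-* 1# (const d ^ₚ n) _ ⟩
        ev 1# (const d ^ₚ n)
          * ev 1# (T.transform (-ₚ 1ₚ) n (λ k → const (a k) *ₚ y ^ₚ k))
          ≈⟨ *-cong (ev-^ (const d) n)
               (transform-homo polyRing R (eval-isHomomorphism 1#) (-ₚ 1ₚ) n _) ⟩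
        ev 1# (const d) ^ n
          * transform (ev 1# (-ₚ 1ₚ)) n (λ k → ev 1# (const (a k) *ₚ y ^ₚ k))
          ≈⟨ *-cong (^-congˡ n (eval-const 1# d))
               (transform-cong n (eval-const 1# (- 1#)) monomial) ⟩
        d ^ n * transform (- 1#) n a ∎
        where
        open ≈-Reasoning setoid

        ev-^ : ∀ p k → ev 1# (p ^ₚ k) ≈ ev 1# p ^ k
        ev-^ = ^-homo polyRing R (eval-isHomomorphism 1#)

        ev-y : ev 1# y ≈ 1#
        ev-y = trans (eval-cong 1# y≈indeterminate)
          (trans (+-identityˡ _) (trans (*-identityˡ _) (eval-const 1# 1#)))

        ev-y^k : ∀ k → ev 1# (y ^ₚ k) ≈ 1#
        ev-y^k zero    = eval-const 1# 1#
        ev-y^k (suc k) = begin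
          ev 1# (y *ₚ y ^ₚ k)       ≈⟨ eval-* 1# y (y ^ₚ k) ⟩
          ev 1# y * ev 1# (y ^ₚ k)  ≈⟨ *-cong ev-y (ev-y^k k) ⟩
          1# * 1#                   ≈⟨ *-identityˡ 1# ⟩
          1#                        ∎

        monomial : ∀ k → ev 1# (const (a k) *ₚ y ^ₚ k) ≈ a k
        monomial k = begin
          ev 1# (const (a k) *ₚ y ^ₚ k)
            ≈⟨ eval-* 1# (const (a k)) (y ^ₚ k) ⟩
          ev 1# (const (a k)) * ev 1# (y ^ₚ k)
            ≈⟨ *-cong (eval-const 1# (a k)) (ev-y^k k) ⟩
          a k * 1#
            ≈⟨ *-identityʳ (a k) ⟩
          a k ∎

      carlitzSum⇒valueSum : ∀ q (U : ℕ → Poly) t →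
        (∀ k → t k ≈ value q (U k)) →
        ∀ a → (∀ n → U n ≈ₚ carlitzSum a n) → ∀ n → U n ≈ₚ valueSum t n
      carlitzSum⇒valueSum q U t t≈ a U≈ n = ≈ₚ-trans (U≈ n) (≈ₚ-sym
        (valueSum≈carlitzSum t a (λ k → trans (t≈ k)
          (trans (eval-cong 1# (U≈ k)) (eval-carlitzSum-1 a k))) n))

      valueSum⇒carlitzSum : ∀ c → c * d ≈ 1# → ∀ (U : ℕ → Poly) t →
        (∀ n → U n ≈ₚ valueSum t n) →
        ∃ λ a → ∀ n → U n ≈ₚ carlitzSum a n
      valueSum⇒carlitzSum c cd≈1 U t U≈ =
        -- Solving `t k = d ^ k * transform (- 1#) k a` for `a`: clear `d ^ k` by `c ^ k`, then
        -- apply the inverse transform, whose parameter is 1.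
        (λ k → transform 1# k (λ j → c ^ j * t j)) ,
        λ n → ≈ₚ-trans (U≈ n)
          (valueSum≈carlitzSum t _ (transform-invert c d cd≈1 t) n)

-- Specialisation to real numbers.

open import Defs

theorem2p2 : (q : ℝ) → 0ℝ < q → (q#1 : q # 1ℝ) →
    let open QCalculus q q#1 in
    (T : ℕ → QPoly) →
    let t : ℕ → ℝ
        t n = QCalculus._at_ q q#1 (T n) 0
    in
    IsCarlitzType T ⇔
      (∀ n → T n ≈ₚ
        ∑[ k ≤ n ] ((n C toℕ k) ×ₚ
          (t (toℕ k) · (q^X ^ₚ toℕ k *ₚ [X] ^ₚ (n ∸ toℕ k)))))
theorem2p2 q _ q#1 T = mk⇔
  (λ { (a , T≈) → carlitzSum⇒valueSum _*_ (- 1ℝ) (QCalculus.1/[q-1] q q#1)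
         -- The proofs `mk≈ (cauchy _)` are reflexivity at the level of sequences: the type of
         -- `cauchy` mentions only `seq`, so no Cauchy proofs have to be compared.
         q^X (QCalculus.[X] q q#1) (λ x z → mk≈ (cauchy (x * z)))
         (mk≈ (cauchy (- 1ℝ))) ≈ₚ-refl ≈ₚ-refl
         q T (λ n → QCalculus._at_ q q#1 (T n) 0)
         (λ k → mk≈ (cauchy (QCalculus._at_ q q#1 (T k) 0))) a T≈ })
  (λ T≈ → valueSum⇒carlitzSum _*_ (- 1ℝ) (QCalculus.1/[q-1] q q#1)
         q^X (QCalculus.[X] q q#1) (λ x z → mk≈ (cauchy (x * z)))
         (mk≈ (cauchy (- 1ℝ))) ≈ₚ-refl ≈ₚ-refl
         (q - 1ℝ)
         -- With `c = q - 1`, this is `c * d ≈ 1#`, rewrapped so that again only sequences are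
         -- compared.
         (mk≈ (sameLimit (*-inverseʳ (q - 1ℝ) (#⇒-#0 {q} {1ℝ} q#1))))
         T (λ n → QCalculus._at_ q q#1 (T n) 0) T≈)
  where open CarlitzType ℝ-commutativeRing
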